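{- The implementation of (fixed-arity) generic interaction rules in the language inets, given by the procedures $\mathtt{reduce}$, $\mathtt{reduceGeneric}$ (run time) and $\mathtt{checkGRC}$ (compile time), satisfies the Default Priority Constraint (DPC) and the Generic Rule Constraint (GRC). That is: (DPC) a call of $\mathtt{reduce}$ on an active pair applies a generic rule only if no ordinary rule for that pair exists; and (GRC) if $\mathtt{checkGRC}$ is run on each generic rule of a program in turn and reports no error, then whenever more than one generic rule of the program can be applied to an active pair, there is also an ordinary rule of the program that can be applied to it (so every violation of the GRC is reported as an error).
   Context: Agents (symbols) $A,B,\ldots$ each have a fixed arity. An active pair is an unordered pair of agents connected by their principal ports. An ordinary rule has a left-hand side $A \bowtie B$ with $A,B$ concrete agents, and can be applied exactly to the active pair $A,B$. For each $n$, $\phi_n$ is a special symbol denoting the generic agent of arity $n$. A fixed generic rule has a left-hand side $A\bowtie\phi_m$ with $A$ a concrete agent, and can be applied to any active pair consisting of $A$ and an agent of arity $m$. Left-hand sides are unordered: $A\bowtie B$ and $B\bowtie A$ are identified. The runtime maintains a table $\mathtt{ruleTable}$ that maps a pair of symbols (two agents, or a generic symbol $\phi_n$ and an agent) to at most one rule; ordinary and fixed generic rules are stored in it under their left-hand sides, and the value is null if there is no such rule. $\mathtt{reduce}(a_1,a_2)$: look up $\mathtt{ruleTable}[a_1][a_2]$. If it is not null, apply that ordinary rule. If it is null, call $\mathtt{reduceGeneric}(a_1,a_2)$; if this returns false, report the error "no matching rule". $\mathtt{reduceGeneric}(a_1,a_2)$: let $n=\mathrm{arity}(a_1)$ and $m=\mathrm{arity}(a_2)$.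 Let $\mathit{rule}=\mathtt{ruleTable}[\phi_n][a_2]$; if this is null, let $\mathit{rule}=\mathtt{ruleTable}[\phi_m][a_1]$; if this is also null, return false. Otherwise apply $\mathit{rule}$ to $(a_1,a_2)$ and return true. $\mathtt{checkGRC}(r)$, called at compile time for each rule $r$ and compared with the already compiled rules: if $r$ is a generic rule, let $A$ be the ordinary agent and $\phi_m$ the generic agent of the left-hand side of $r$, and let $n=\mathrm{arity}(A)$. If there exists an already compiled generic rule with left-hand side $B\bowtie\phi_n$ with $\mathrm{arity}(B)=m$, and no ordinary rule with left-hand side $A\bowtie B$ exists, report the error "generic rule overlap". Then add $r$ to the existing rules. Constraints. Default Priority Constraint (DPC): an active pair (equation) $\alpha(\overline{t_1})=\beta(\overline{t_2})$ can be reduced using a generic rule only if no matching ordinary rule exists. Generic Rule Constraint (GRC): if more than one generic rule can be applied to a given active pair $\alpha(\overline{t_1})=\beta(\overline{t_2})$, there must exist an ordinary rule that can be applied to it as well. -}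

module Defs where

open import Data.Bool using (Bool; false; if_then_else_; not; _∧_)
open import Data.List using (List; []; _∷_; _++_; [_]; foldl)
open import Data.Bool.ListAction using (any)
open import Data.List.Membership.Propositional using (_∈_)
open import Data.Maybe using (Maybe; just; nothing)
open import Data.Nat using (ℕ)
import Data.Nat as ℕ
open import Data.Product using (∃-syntax; _×_; _,_)
open import Data.Sum using (_⊎_)
open import Data.Unit using (⊤)
open import Data.Empty using (⊥)
open import Relation.Binary.Definitions using (DecidableEquality)
open import Relation.Binary.PropositionalEquality using (_≡_; _≢_; refl; cong)
open import Relation.Nullary using (¬_; Dec; no; does)
open import Relation.Nullary.Decidable using (map′; _×-dec_; _⊎-dec_)

-- Equality of unordered pairs.
_≈_ : {X : Set} → X × X → X × X → Set
(x , y) ≈ (u , v) = (x ≡ u × y ≡ v) ⊎ (x ≡ v × y ≡ u)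

-- Right-hand sides stay abstract: neither the lookup procedures nor the
-- constraints inspect the net by which a rule replaces an active pair.
record Signature : Set₁ where
  field
    Agent : Set
    _≟_   : DecidableEquality Agent
    arity : Agent → ℕ
    RHS   : Set

module Inets (S : Signature) where
  open Signature S

  data Symbol : Set where
    agent : Agent → Symbol
    φ     : ℕ → Symbol

  _≟ₛ_ : DecidableEquality Symbol
  agent A ≟ₛ agent B = map′ (cong agent) (λ { refl → refl }) (A ≟ B)
  agent A ≟ₛ φ n     = no λ ()
  φ m     ≟ₛ agent B = no λ ()
  φ m     ≟ₛ φ n     = map′ (cong φ) (λ { refl → refl }) (m ℕ.≟ n)

  _≈?_ : (p q : Symbol × Symbol) → Dec (p ≈ q)
  (x , y) ≈? (u , v) =
    ((x ≟ₛ u) ×-dec (y ≟ₛ v)) ⊎-dec ((x ≟ₛ v) ×-dec (y ≟ₛ u))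

  data LHS : Set where
    _⋈_  : Agent → Agent → LHS
    _⋈φ_ : Agent → ℕ → LHS

  symbols : LHS → Symbol × Symbol
  symbols (A ⋈ B)  = agent A , agent B
  symbols (A ⋈φ m) = agent A , φ m

  record Rule : Set where
    constructor _⟶_
    field
      lhs : LHS
      rhs : RHS
  open Rule public

  Ordinary : Rule → Set
  Ordinary ((_ ⋈ _) ⟶ _)  = ⊤
  Ordinary ((_ ⋈φ _) ⟶ _) = ⊥

  Generic : Rule → Set
  Generic ((_ ⋈ _) ⟶ _)  = ⊥
  Generic ((_ ⋈φ _) ⟶ _) = ⊤

  -- Active pairs are unordered, hence the two orientations in each clause.
  Applicable : Rule → Agent → Agent → Set
  Applicable ((A ⋈ B) ⟶ _)  a₁ a₂ = (a₁ , a₂) ≈ (A , B)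
  Applicable ((A ⋈φ m) ⟶ _) a₁ a₂ =
    (a₁ ≡ A × arity a₂ ≡ m) ⊎ (a₂ ≡ A × arity a₁ ≡ m)

  -- Rules in the order in which they are compiled; ordinary and generic rules
  -- may be interleaved arbitrarily.
  Program : Set
  Program = List Rule

  AtMostOneRulePerLHS : Program → Set
  AtMostOneRulePerLHS P =
    ∀ {r s} → r ∈ P → s ∈ P → symbols (lhs r) ≈ symbols (lhs s) → r ≡ s

  Table : Set
  Table = Symbol → Symbol → Maybe Rule

  -- Storing under an occupied left-hand side overwrites the old entry.
  store : Table → Rule → Table
  store T r x y = if does ((x , y) ≈? symbols (lhs r)) then just r else T x y

  ruleTable : Program → Table
  ruleTable = foldl store (λ _ _ → nothing)

  -- The rule that is applied; nothing stands for the return value false.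
  reduceGeneric : Table → Agent → Agent → Maybe Rule
  reduceGeneric T a₁ a₂ with T (φ (arity a₁)) (agent a₂)
  ... | just r  = just r
  ... | nothing = T (φ (arity a₂)) (agent a₁)

  data Outcome : Set where
    applied        : Rule → Outcome
    noMatchingRule : Outcome

  reduce : Table → Agent → Agent → Outcome
  reduce T a₁ a₂ with T (agent a₁) (agent a₂)
  ... | just r  = applied r
  ... | nothing with reduceGeneric T a₁ a₂
  ...   | just r  = applied r
  ...   | nothing = noMatchingRule

  data CompileError : Set where
    genericRuleOverlap : Rule → CompileError

  record CompilerState : Set where
    constructor state
    field
      compiled : List Rule
      errors   : List CompileError
  open CompilerState public

  hasOrdinary : Agent → Agent → List Rule → Bool
  hasOrdinary A B = any λ s → does (symbols (lhs s) ≈? (agent A , agent B))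

  overlaps : Rule → List Rule → Bool
  overlaps ((_ ⋈ _) ⟶ _)  _  = false
  overlaps ((A ⋈φ m) ⟶ _) rs = any conflict rs
    where
    conflict : Rule → Bool
    conflict ((_ ⋈ _) ⟶ _)  = false
    conflict ((B ⋈φ n) ⟶ _) =
      does (n ℕ.≟ arity A) ∧ does (arity B ℕ.≟ m) ∧ not (hasOrdinary A B rs)

  -- The rule is added even when an error is reported.
  checkGRC : CompilerState → Rule → CompilerState
  checkGRC (state rs es) r =
    state (rs ++ [ r ])
          (if overlaps r rs then es ++ [ genericRuleOverlap r ] else es)

  compile : Program → CompilerState
  compile = foldl checkGRC (state [] [])

  OrdinaryRuleFor : Program → Agent → Agent → Set
  OrdinaryRuleFor P a₁ a₂ = ∃[ r ] r ∈ P × Ordinary r × Applicable r a₁ a₂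

  MoreThanOneGenericRuleFor : Program → Agent → Agent → Set
  MoreThanOneGenericRuleFor P a₁ a₂ = ∃[ r ] ∃[ s ] r ≢ s
    × (r ∈ P × Generic r × Applicable r a₁ a₂)
    × (s ∈ P × Generic s × Applicable s a₁ a₂)

  DPC : Program → Set
  DPC P = ∀ a₁ a₂ r → reduce (ruleTable P) a₁ a₂ ≡ applied r → Generic r →
    ¬ OrdinaryRuleFor P a₁ a₂

  GRC : Program → Set
  GRC P = ∀ a₁ a₂ → MoreThanOneGenericRuleFor P a₁ a₂ → OrdinaryRuleFor P a₁ a₂

  GRCViolation : Program → Set
  GRCViolation P =
    ∃[ a₁ ] ∃[ a₂ ] MoreThanOneGenericRuleFor P a₁ a₂ × ¬ OrdinaryRuleFor P a₁ a₂

module Submission where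

open import Data.Bool using (true; false; T; T?; not; _∧_; if_then_else_)
open import Data.Bool.Properties using (T-≡; T-∧; T-not-≡; ¬-not)
open import Data.List using (List; []; _∷_; _++_; [_]; foldl)
open import Data.List.Membership.Propositional using (_∈_; find)
open import Data.List.Membership.Propositional.Properties using (∈-++⁺ˡ; ∈-++⁻)
open import Data.List.Properties using (++-assoc; ++-identityʳ)
open import Data.List.Relation.Unary.Any using (here; there)
import Data.List.Relation.Unary.Any as Any
open import Data.List.Relation.Unary.Any.Properties using (any⁺; any⁻)
open import Data.Maybe using (Maybe; just; nothing)
open import Data.Nat using (_≟_)
open import Data.Product using (_×_; _,_; proj₂)
open import Data.Sum using (_⊎_; inj₁; inj₂)
open import Data.Unit using (tt)
open import Function using (_∘_)
open import Function.Bundles using (Equivalence)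
open import Relation.Binary.PropositionalEquality
  using (_≡_; _≢_; refl; sym; subst; ≢-sym)
open import Relation.Nullary using (¬_; Dec; yes; no; does; contradiction)
open import Relation.Nullary.Decidable using (dec-true)
open import Defs

-- For the DPC, a table entry under two concrete agents can only be an ordinary rule, and it is null
-- only if no rule of the program has that left-hand side. So the direct lookup in `reduce` never
-- yields a generic rule, and the fallback is reached only when no ordinary rule matches.
--
-- For the GRC, let two distinct generic rules apply to one pair. In the same orientation they have
-- equal left-hand sides, which `AtMostOneRulePerLHS` excludes. So they cross: `A ⋈φ arity B` and
-- `B ⋈φ arity A`. Whichever is compiled later meets the other in `checkGRC`, and silence means that
-- an ordinary rule for `A` and `B` was already present (`crossing-generic⇒ordinary`). Reported
-- errors are never dropped, so an empty final list means that every check was silent, and the GRC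
-- is an invariant of the compiled prefix (`GRC-snoc`, `foldl-checkGRC-GRC`).

≈-sym : {X : Set} {p q : X × X} → p ≈ q → q ≈ p
≈-sym (inj₁ (refl , refl)) = inj₁ (refl , refl)
≈-sym (inj₂ (refl , refl)) = inj₂ (refl , refl)

T-does⁺ : {P : Set} (P? : Dec P) → P → T (does P?)
T-does⁺ P? p = Equivalence.from T-≡ (dec-true P? p)

T-does⁻ : {P : Set} (P? : Dec P) → T (does P?) → P
T-does⁻ (yes p) _ = p

if-does-nothing : {P X : Set} (P? : Dec P) {x : X} {m : Maybe X} →
  (if does P? then just x else m) ≡ nothing → ¬ P × m ≡ nothing
if-does-nothing (no ¬p) eq = ¬p , eq

if-does-just : {P X : Set} (P? : Dec P) {x y : X} {m : Maybe X} →
  (if does P? then just x else m) ≡ just y → (P × x ≡ y) ⊎ m ≡ just y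
if-does-just (yes p) refl = inj₁ (p , refl)
if-does-just (no _)  eq   = inj₂ eq

++-∷≢[] : {X : Set} (xs : List X) {y : X} {ys : List X} → xs ++ y ∷ ys ≢ []
++-∷≢[] []      ()
++-∷≢[] (_ ∷ _) ()

module _ (S : Signature) where
  open Signature S using (arity)
  open Inets S

  -- `store` may overwrite an entry but never clears one, so a null at the end was null throughout
  -- and no rule wrote there. The start table is arbitrary because `foldl` changes it at each step.
  foldl-store-nothing : ∀ T P {x y r} → foldl store T P x y ≡ nothing →
    T x y ≡ nothing × (r ∈ P → ¬ (x , y) ≈ symbols (lhs r))
  foldl-store-nothing T [] eq = eq , λ ()
  foldl-store-nothing T (s ∷ P) {x} {y} eq with foldl-store-nothing (store T s) P eq
  ... | store≡nothing , r∉P with if-does-nothing ((x , y) ≈? symbols (lhs s)) store≡nothing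
  ... | x≉s , Txy≡nothing =
    Txy≡nothing , λ { (here refl) → x≉s ; (there r∈P) → r∉P r∈P }

  foldl-store-just : ∀ T P {x y r} → foldl store T P x y ≡ just r →
    T x y ≡ just r ⊎ (x , y) ≈ symbols (lhs r)
  foldl-store-just T [] eq = inj₁ eq
  foldl-store-just T (s ∷ P) {x} {y} eq with foldl-store-just (store T s) P eq
  ... | inj₂ xy≈r = inj₂ xy≈r
  ... | inj₁ store≡just with if-does-just ((x , y) ≈? symbols (lhs s)) store≡just
  ... | inj₁ (xy≈s , refl) = inj₂ xy≈s
  ... | inj₂ Txy≡just      = inj₁ Txy≡just

  agents≉generic : ∀ {a b r} → Generic r → ¬ (agent a , agent b) ≈ symbols (lhs r)
  agents≉generic {r = (_ ⋈φ _) ⟶ _} _ (inj₁ (_ , ()))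
  agents≉generic {r = (_ ⋈φ _) ⟶ _} _ (inj₂ (() , _))

  ordinary-symbols : ∀ {a b r} → Ordinary r → Applicable r a b →
    (agent a , agent b) ≈ symbols (lhs r)
  ordinary-symbols {r = (_ ⋈ _) ⟶ _} _ (inj₁ (refl , refl)) = inj₁ (refl , refl)
  ordinary-symbols {r = (_ ⋈ _) ⟶ _} _ (inj₂ (refl , refl)) = inj₂ (refl , refl)

  symbols-ordinary : ∀ {a b} r → (agent a , agent b) ≈ symbols (lhs r) →
    Ordinary r × Applicable r a b
  symbols-ordinary ((_ ⋈ _) ⟶ _)  (inj₁ (refl , refl)) = tt , inj₁ (refl , refl)
  symbols-ordinary ((_ ⋈ _) ⟶ _)  (inj₂ (refl , refl)) = tt , inj₂ (refl , refl)
  symbols-ordinary ((_ ⋈φ _) ⟶ _) (inj₁ (_ , ()))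
  symbols-ordinary ((_ ⋈φ _) ⟶ _) (inj₂ (() , _))

  dpc : ∀ P → DPC P
  dpc P a₁ a₂ r eq gen (s , s∈P , ord , app)
    with ruleTable P (agent a₁) (agent a₂) in look
  dpc P a₁ a₂ r refl gen _ | just _ with foldl-store-just _ P look
  -- The case `inj₁` is absurd: the initial table is `nothing` everywhere.
  ... | inj₂ a≈r = agents≉generic {r = r} gen a≈r
  dpc P a₁ a₂ r eq gen (s , s∈P , ord , app) | nothing =
    proj₂ (foldl-store-nothing _ P look) s∈P (ordinary-symbols {r = s} ord app)

  OrdinaryRuleFor-swap : ∀ {P a b} → OrdinaryRuleFor P a b → OrdinaryRuleFor P b a
  OrdinaryRuleFor-swap ((_ ⋈ _) ⟶ _ , r∈P , tt , inj₁ (refl , refl)) =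
    _ , r∈P , tt , inj₂ (refl , refl)
  OrdinaryRuleFor-swap ((_ ⋈ _) ⟶ _ , r∈P , tt , inj₂ (refl , refl)) =
    _ , r∈P , tt , inj₁ (refl , refl)

  OrdinaryRuleFor-++ˡ : ∀ {P Q a b} → OrdinaryRuleFor P a b → OrdinaryRuleFor (P ++ Q) a b
  OrdinaryRuleFor-++ˡ (r , r∈P , ord-app) = r , ∈-++⁺ˡ r∈P , ord-app

  -- The test compares symbols only, but two concrete agents never match a left-hand side containing
  -- a `φ`, so the rule found is ordinary.
  hasOrdinary-sound : ∀ A B P → T (hasOrdinary A B P) → OrdinaryRuleFor P A B
  hasOrdinary-sound A B P has with find (any⁻ _ P has)
  ... | r , r∈P , match =
    r , r∈P , symbols-ordinary r (≈-sym (T-does⁻ (symbols (lhs r) ≈? _) match))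

  -- If `hasOrdinary` failed, the crossing rule in `P` would itself be a witness for `overlaps`:
  -- both arity tests hold by reflexivity.
  crossing-generic⇒ordinary : ∀ {P A B e f} →
    ¬ T (overlaps ((A ⋈φ arity B) ⟶ e) P) → ((B ⋈φ arity A) ⟶ f) ∈ P →
    OrdinaryRuleFor P A B
  crossing-generic⇒ordinary {P} {A} {B} ¬overlap s∈P with T? (hasOrdinary A B P)
  ... | yes has = hasOrdinary-sound A B P has
  ... | no ¬has = contradiction (any⁺ _ (Any.map (λ { refl → conflict }) s∈P)) ¬overlap
    where
    conflict : T (does (arity A ≟ arity A) ∧ does (arity B ≟ arity B)
                  ∧ not (hasOrdinary A B P))
    conflict = Equivalence.from T-∧
      ( T-does⁺ (arity A ≟ arity A) refl
      , Equivalence.from T-∧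
          ( T-does⁺ (arity B ≟ arity B) refl
          , Equivalence.from T-not-≡ (¬-not (¬has ∘ Equivalence.from T-≡))))

  -- Two generic rules applicable to the same pair either share a left-hand
  -- side, or match the pair in opposite orientations.
  no-overlap⇒ordinary : ∀ {P r s a b} →
    ¬ T (overlaps r P) → (symbols (lhs r) ≈ symbols (lhs s) → r ≡ s) → r ≢ s →
    Generic r → Applicable r a b → s ∈ P → Generic s → Applicable s a b →
    OrdinaryRuleFor P a b
  no-overlap⇒ordinary {r = (_ ⋈φ _) ⟶ e} {(_ ⋈φ _) ⟶ _} ¬o uniq r≢s _
    (inj₁ (refl , refl)) s∈P _ (inj₁ (refl , refl)) =
    contradiction (uniq (inj₁ (refl , refl))) r≢s
  no-overlap⇒ordinary {r = (_ ⋈φ _) ⟶ e} {(_ ⋈φ _) ⟶ _} ¬o uniq r≢s _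
    (inj₂ (refl , refl)) s∈P _ (inj₂ (refl , refl)) =
    contradiction (uniq (inj₁ (refl , refl))) r≢s
  no-overlap⇒ordinary {r = (_ ⋈φ _) ⟶ e} {(_ ⋈φ _) ⟶ _} ¬o uniq r≢s _
    (inj₁ (refl , refl)) s∈P _ (inj₂ (refl , refl)) =
    crossing-generic⇒ordinary {e = e} ¬o s∈P
  no-overlap⇒ordinary {r = (_ ⋈φ _) ⟶ e} {(_ ⋈φ _) ⟶ _} ¬o uniq r≢s _
    (inj₂ (refl , refl)) s∈P _ (inj₁ (refl , refl)) =
    OrdinaryRuleFor-swap (crossing-generic⇒ordinary {e = e} ¬o s∈P)

  GRC-snoc : ∀ {P t} → AtMostOneRulePerLHS (P ++ [ t ]) → ¬ T (overlaps t P) →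
    GRC P → GRC (P ++ [ t ])
  GRC-snoc {P} uniq ¬o grc a b (r , s , r≢s , (r∈ , gr , ar) , (s∈ , gs , as))
    with ∈-++⁻ P r∈ | ∈-++⁻ P s∈
  ... | inj₁ r∈P | inj₁ s∈P =
    OrdinaryRuleFor-++ˡ (grc a b (r , s , r≢s , (r∈P , gr , ar) , (s∈P , gs , as)))
  -- The new rule is now the second of the two. The roles are exchanged, because it is the new rule
  -- whose check against `P` is known to be silent.
  ... | inj₁ r∈P | inj₂ (here refl) =
    OrdinaryRuleFor-++ˡ (no-overlap⇒ordinary ¬o (uniq s∈ r∈) (≢-sym r≢s) gs as r∈P gr ar)
  ... | inj₂ (here refl) | inj₁ s∈P =
    OrdinaryRuleFor-++ˡ (no-overlap⇒ordinary ¬o (uniq r∈ s∈) r≢s gr ar s∈P gs as)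
  ... | inj₂ (here refl) | inj₂ (here refl) = contradiction refl r≢s

  errors-persist : ∀ P {rs es} → es ≢ [] → errors (foldl checkGRC (state rs es) P) ≢ []
  errors-persist []      es≢[] = es≢[]
  errors-persist (t ∷ P) {rs} {es} es≢[] with overlaps t rs
  ... | true  = errors-persist P (++-∷≢[] es)
  ... | false = errors-persist P es≢[]

  -- The induction runs over the rules still to be compiled, with `GRC rs` as invariant for those
  -- already compiled. Uniqueness is assumed of the whole program `rs ++ P`, so that it restricts to
  -- every prefix.
  foldl-checkGRC-GRC : ∀ P {rs es} → AtMostOneRulePerLHS (rs ++ P) → GRC rs →
    errors (foldl checkGRC (state rs es) P) ≡ [] → GRC (rs ++ P)
  foldl-checkGRC-GRC [] {rs} _ grc _ = subst GRC (sym (++-identityʳ rs)) grc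
  foldl-checkGRC-GRC (t ∷ P) {rs} {es} uniq grc ok
    with overlaps t rs in eq
  ... | true  = contradiction ok (errors-persist P (++-∷≢[] es))
  ... | false = subst GRC (++-assoc rs [ t ] P)
    (foldl-checkGRC-GRC P uniq′
      -- Since `T false` is empty, `subst T eq` is the required refutation of `T (overlaps t rs)`.
      (GRC-snoc (λ r∈ s∈ → uniq′ (∈-++⁺ˡ r∈) (∈-++⁺ˡ s∈)) (subst T eq) grc) ok)
    where
    uniq′ : AtMostOneRulePerLHS ((rs ++ [ t ]) ++ P)
    uniq′ = subst AtMostOneRulePerLHS (sym (++-assoc rs [ t ] P)) uniq

  no-errors⇒GRC : ∀ P → AtMostOneRulePerLHS P → errors (compile P) ≡ [] → GRC P
  no-errors⇒GRC P uniq = foldl-checkGRC-GRC P uniq λ { _ _ (_ , _ , _ , (() , _) , _) }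

proposition4p1p1 : (S : Signature) → let open Inets S in
    (P : Program) →
    DPC P
    × (AtMostOneRulePerLHS P →
    (errors (compile P) ≡ [] → GRC P)
    × (GRCViolation P → errors (compile P) ≢ []))
proposition4p1p1 S P =
  dpc S P , λ uniq →
    no-errors⇒GRC S P uniq ,
    λ { (a₁ , a₂ , many , ¬ord) ok → ¬ord (no-errors⇒GRC S P uniq ok a₁ a₂ many) }
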